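{- For every world expression $w$, the judgement $\cdot;\cdot\vdash\mathbf 0@w$ (empty unrestricted and linear contexts) is not derivable in natural deduction for HyLL (described in the context).
   Context: Fix a constraint domain, i.e. a monoid $\mathcal W=\langle W,\cdot,\iota\rangle$ whose elements are called worlds. World expressions $u,v,w$ are built from world variables and elements of $W$ using $\cdot$; terms are built from term variables and function symbols. HyLL propositions are $A,B::= a\,\vec t \mid A\otimes B\mid \mathbf 1\mid A\multimap B\mid A\,\&\,B\mid\top\mid A\oplus B\mid \mathbf 0\mid\, !A\mid \forall x.A\mid\exists x.A\mid (A\ \mathrm{at}\ w)\mid \downarrow u.A\mid\forall u.A\mid \exists u.A$, with $a$ a predicate symbol applied to terms, $x$ a term variable, $u$ a world variable ($\downarrow u$, $\forall u$, $\exists u$ bind $u$). $\alpha$ ranges over variables of either kind, $\tau$ over terms or world expressions accordingly, $[\tau/\alpha]A$ is capture-avoiding substitution, and propositions are identified up to $\alpha$-conversion. A judgement is $A@w$. Natural deduction judgements $\Gamma;\Delta\vdash C@w$ ($\Gamma$ a set, $\Delta$ a multiset of judgements) are generated by: hyp: $\Gamma;A@w\vdash A@w$; hyp!: $\Gamma,A@w;\cdot\vdash A@w$; $\otimes$I: from $\Gamma;\Delta\vdash A@w$, $\Gamma;\Delta'\vdash B@w$ infer $\Gamma;\Delta,\Delta'\vdash A\otimes B@w$; $\otimes$E: from $\Gamma;\Delta\vdash A\otimes B@w$, $\Gamma;\Delta',A@w,B@w\vdash C@w'$ infer $\Gamma;\Delta,\Delta'\vdash C@w'$; $\mathbf1$I: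 $\Gamma;\cdot\vdash\mathbf1@w$; $\mathbf1$E: from $\Gamma;\Delta\vdash\mathbf1@w$, $\Gamma;\Delta'\vdash C@w'$ infer $\Gamma;\Delta,\Delta'\vdash C@w'$; $\multimap$I: from $\Gamma;\Delta,A@w\vdash B@w$ infer $\Gamma;\Delta\vdash A\multimap B@w$; $\multimap$E: from $\Gamma;\Delta\vdash A\multimap B@w$, $\Gamma;\Delta'\vdash A@w$ infer $\Gamma;\Delta,\Delta'\vdash B@w$; $\&$I: from $\Gamma;\Delta\vdash A@w$, $\Gamma;\Delta\vdash B@w$ infer $\Gamma;\Delta\vdash A\&B@w$; $\&$E$_i$: from $\Gamma;\Delta\vdash A_1\&A_2@w$ infer $\Gamma;\Delta\vdash A_i@w$; $\oplus$I$_i$: from $\Gamma;\Delta\vdash A_i@w$ infer $\Gamma;\Delta\vdash A_1\oplus A_2@w$; $\oplus$E: from $\Gamma;\Delta\vdash A\oplus B@w$, $\Gamma;\Delta',A@w\vdash C@w'$, $\Gamma;\Delta',B@w\vdash C@w'$ infer $\Gamma;\Delta,\Delta'\vdash C@w'$; $\top$I: $\Gamma;\Delta\vdash\top@w$; $\mathbf0$E: from $\Gamma;\Delta\vdash\mathbf0@w$ infer $\Gamma;\Delta,\Delta'\vdash C@w'$; $\forall$I: from $\Gamma;\Delta\vdash A@w$ infer $\Gamma;\Delta\vdash\forall\alpha.A@w$ ($\alpha$ fresh); $\forall$E: from $\Gamma;\Delta\vdash\forall\alpha.A@w$ infer $\Gamma;\Delta\vdash[\tau/\alpha]A@w$; $\exists$I: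 from $\Gamma;\Delta\vdash[\tau/\alpha]A@w$ infer $\Gamma;\Delta\vdash\exists\alpha.A@w$; $\exists$E: from $\Gamma;\Delta\vdash\exists\alpha.A@w$, $\Gamma;\Delta',A@w\vdash C@w'$ ($\alpha$ fresh) infer $\Gamma;\Delta,\Delta'\vdash C@w'$; !I: from $\Gamma;\cdot\vdash A@w$ infer $\Gamma;\cdot\vdash!A@w$; !E: from $\Gamma;\Delta\vdash!A@w$, $\Gamma,A@w;\Delta'\vdash C@w'$ infer $\Gamma;\Delta,\Delta'\vdash C@w'$; at I: from $\Gamma;\Delta\vdash A@w$ infer $\Gamma;\Delta\vdash(A\ \mathrm{at}\ w)@w'$; at E: from $\Gamma;\Delta\vdash(A\ \mathrm{at}\ w)@w'$ infer $\Gamma;\Delta\vdash A@w$; $\downarrow$I: from $\Gamma;\Delta\vdash[w/u]A@w$ infer $\Gamma;\Delta\vdash\downarrow u.A@w$; $\downarrow$E: from $\Gamma;\Delta\vdash\downarrow u.A@w$ infer $\Gamma;\Delta\vdash[w/u]A@w$. -}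

module Defs where

open import Level using (Level; _⊔_)
open import Data.Nat using (ℕ; zero; suc; _<ᵇ_; _≡ᵇ_)
open import Data.Bool using (if_then_else_)
open import Data.List using (List; []; _∷_; _++_; map)
open import Data.List.Membership.Propositional using (_∈_)
open import Data.List.Relation.Binary.Permutation.Propositional using (_↭_)
open import Algebra.Bundles using (Monoid)

-- HyLL over a constraint domain given by a monoid M (the worlds are the
-- elements of its carrier), a set F of function symbols and a set P of
-- predicate symbols.  Variables are de Bruijn indices; term variables and
-- world variables live in separate index spaces.  Binders (∀/∃ over terms,
-- ↓/∀/∃ over worlds) bind index 0 of their kind.  This makes
-- alpha-equivalent propositions syntactically equal and substitution
-- capture-avoiding by construction.
module HyLL {c ℓ : Level} (M : Monoid c ℓ) (F P : Set) where

  open Monoid M using (Carrier)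

  data World : Set c where
    wvar : ℕ → World
    wel  : Carrier → World
    _·_  : World → World → World

  data Term : Set where
    var : ℕ → Term
    app : F → List Term → Term

  infixr 6 _⊗_ _&_ _⊕_
  infixr 5 _⊸_
  infix 4 _at_

  data Prop : Set c where
    atom  : P → List Term → Prop
    _⊗_   : Prop → Prop → Prop
    𝟙     : Prop
    _⊸_   : Prop → Prop → Prop
    _&_   : Prop → Prop → Prop
    ⊤ₚ    : Prop
    _⊕_   : Prop → Prop → Prop
    𝟘     : Prop
    !_    : Prop → Prop
    all-t : Prop → Prop
    ex-t  : Prop → Prop
    _at_  : Prop → World → Prop
    down  : Prop → Prop
    all-w : Prop → Prop
    ex-w  : Prop → Prop

  liftIdx : ℕ → ℕ → ℕ
  liftIdx k n = if n <ᵇ k then n else suc n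

  shiftWW : ℕ → World → World
  shiftWW k (wvar n) = wvar (liftIdx k n)
  shiftWW k (wel x)  = wel x
  shiftWW k (u · v)  = shiftWW k u · shiftWW k v

  -- replace world index k by s, lowering the indices above k
  substWW : ℕ → World → World → World
  substWW k s (wvar zero)    = if k ≡ᵇ zero then s else wvar zero
  substWW k s (wvar (suc n)) =
    if suc n <ᵇ k then wvar (suc n) else (if k ≡ᵇ suc n then s else wvar n)
  substWW k s (wel x)  = wel x
  substWW k s (u · v)  = substWW k s u · substWW k s v

  mutual
    shiftTm : ℕ → Term → Term
    shiftTm k (var n)    = var (liftIdx k n)
    shiftTm k (app f ts) = app f (shiftTms k ts)

    shiftTms : ℕ → List Term → List Term
    shiftTms k []       = []
    shiftTms k (t ∷ ts) = shiftTm k t ∷ shiftTms k ts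

  mutual
    substTm : ℕ → Term → Term → Term
    substTm k s (var zero)    = if k ≡ᵇ zero then s else var zero
    substTm k s (var (suc n)) =
      if suc n <ᵇ k then var (suc n) else (if k ≡ᵇ suc n then s else var n)
    substTm k s (app f ts) = app f (substTms k s ts)

    substTms : ℕ → Term → List Term → List Term
    substTms k s []       = []
    substTms k s (t ∷ ts) = substTm k s t ∷ substTms k s ts

  shiftTP : ℕ → Prop → Prop
  shiftTP k (atom a ts) = atom a (shiftTms k ts)
  shiftTP k (A ⊗ B) = shiftTP k A ⊗ shiftTP k B
  shiftTP k 𝟙 = 𝟙
  shiftTP k (A ⊸ B) = shiftTP k A ⊸ shiftTP k B
  shiftTP k (A & B) = shiftTP k A & shiftTP k B
  shiftTP k ⊤ₚ = ⊤ₚ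
  shiftTP k (A ⊕ B) = shiftTP k A ⊕ shiftTP k B
  shiftTP k 𝟘 = 𝟘
  shiftTP k (! A) = ! shiftTP k A
  shiftTP k (all-t A) = all-t (shiftTP (suc k) A)
  shiftTP k (ex-t A) = ex-t (shiftTP (suc k) A)
  shiftTP k (A at w) = shiftTP k A at w
  shiftTP k (down A) = down (shiftTP k A)
  shiftTP k (all-w A) = all-w (shiftTP k A)
  shiftTP k (ex-w A) = ex-w (shiftTP k A)

  shiftWP : ℕ → Prop → Prop
  shiftWP k (atom a ts) = atom a ts
  shiftWP k (A ⊗ B) = shiftWP k A ⊗ shiftWP k B
  shiftWP k 𝟙 = 𝟙
  shiftWP k (A ⊸ B) = shiftWP k A ⊸ shiftWP k B
  shiftWP k (A & B) = shiftWP k A & shiftWP k B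
  shiftWP k ⊤ₚ = ⊤ₚ
  shiftWP k (A ⊕ B) = shiftWP k A ⊕ shiftWP k B
  shiftWP k 𝟘 = 𝟘
  shiftWP k (! A) = ! shiftWP k A
  shiftWP k (all-t A) = all-t (shiftWP k A)
  shiftWP k (ex-t A) = ex-t (shiftWP k A)
  shiftWP k (A at w) = shiftWP k A at shiftWW k w
  shiftWP k (down A) = down (shiftWP (suc k) A)
  shiftWP k (all-w A) = all-w (shiftWP (suc k) A)
  shiftWP k (ex-w A) = ex-w (shiftWP (suc k) A)

  substTP : ℕ → Term → Prop → Prop
  substTP k s (atom a ts) = atom a (substTms k s ts)
  substTP k s (A ⊗ B) = substTP k s A ⊗ substTP k s B
  substTP k s 𝟙 = 𝟙
  substTP k s (A ⊸ B) = substTP k s A ⊸ substTP k s B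
  substTP k s (A & B) = substTP k s A & substTP k s B
  substTP k s ⊤ₚ = ⊤ₚ
  substTP k s (A ⊕ B) = substTP k s A ⊕ substTP k s B
  substTP k s 𝟘 = 𝟘
  substTP k s (! A) = ! substTP k s A
  substTP k s (all-t A) = all-t (substTP (suc k) (shiftTm zero s) A)
  substTP k s (ex-t A) = ex-t (substTP (suc k) (shiftTm zero s) A)
  substTP k s (A at w) = substTP k s A at w
  substTP k s (down A) = down (substTP k s A)
  substTP k s (all-w A) = all-w (substTP k s A)
  substTP k s (ex-w A) = ex-w (substTP k s A)

  substWP : ℕ → World → Prop → Prop
  substWP k s (atom a ts) = atom a ts
  substWP k s (A ⊗ B) = substWP k s A ⊗ substWP k s B
  substWP k s 𝟙 = 𝟙
  substWP k s (A ⊸ B) = substWP k s A ⊸ substWP k s B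
  substWP k s (A & B) = substWP k s A & substWP k s B
  substWP k s ⊤ₚ = ⊤ₚ
  substWP k s (A ⊕ B) = substWP k s A ⊕ substWP k s B
  substWP k s 𝟘 = 𝟘
  substWP k s (! A) = ! substWP k s A
  substWP k s (all-t A) = all-t (substWP k s A)
  substWP k s (ex-t A) = ex-t (substWP k s A)
  substWP k s (A at w) = substWP k s A at substWW k s w
  substWP k s (down A) = down (substWP (suc k) (shiftWW zero s) A)
  substWP k s (all-w A) = all-w (substWP (suc k) (shiftWW zero s) A)
  substWP k s (ex-w A) = ex-w (substWP (suc k) (shiftWW zero s) A)

  instT : Term → Prop → Prop
  instT t A = substTP zero t A

  instW : World → Prop → Prop
  instW w A = substWP zero w A

  infix 3 _＠_
  data Jdg : Set c where
    _＠_ : Prop → World → Jdg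

  ↑tJ : Jdg → Jdg
  ↑tJ (A ＠ w) = shiftTP zero A ＠ w

  ↑wJ : Jdg → Jdg
  ↑wJ (A ＠ w) = shiftWP zero A ＠ shiftWW zero w

  Ctx : Set c
  Ctx = List Jdg

  -- Natural deduction  Γ ; Δ ⊢ C ＠ w.
  -- Γ (unrestricted, a set) is a list read up to membership;
  -- Δ (linear, a multiset) is a list, and every rule combining two linear
  -- contexts Δ, Δ' concludes for any Δ₀ that is a permutation of Δ ++ Δ'.
  -- Freshness of α in ∀I / ∃E is realised by de Bruijn shifting.

  infix 2 _⨾_⊢_
  data _⨾_⊢_ : Ctx → Ctx → Jdg → Set c where
    hyp  : ∀ {Γ A w} → Γ ⨾ (A ＠ w) ∷ [] ⊢ A ＠ w
    hyp! : ∀ {Γ A w} → (A ＠ w) ∈ Γ → Γ ⨾ [] ⊢ A ＠ w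

    ⊗I : ∀ {Γ Δ Δ' Δ₀ A B w} → Δ₀ ↭ Δ ++ Δ' →
         Γ ⨾ Δ ⊢ A ＠ w → Γ ⨾ Δ' ⊢ B ＠ w → Γ ⨾ Δ₀ ⊢ A ⊗ B ＠ w
    ⊗E : ∀ {Γ Δ Δ' Δ₀ A B C w w'} → Δ₀ ↭ Δ ++ Δ' →
         Γ ⨾ Δ ⊢ A ⊗ B ＠ w → Γ ⨾ (A ＠ w) ∷ (B ＠ w) ∷ Δ' ⊢ C ＠ w' →
         Γ ⨾ Δ₀ ⊢ C ＠ w'

    𝟙I : ∀ {Γ w} → Γ ⨾ [] ⊢ 𝟙 ＠ w
    𝟙E : ∀ {Γ Δ Δ' Δ₀ C w w'} → Δ₀ ↭ Δ ++ Δ' →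
         Γ ⨾ Δ ⊢ 𝟙 ＠ w → Γ ⨾ Δ' ⊢ C ＠ w' → Γ ⨾ Δ₀ ⊢ C ＠ w'

    ⊸I : ∀ {Γ Δ A B w} → Γ ⨾ (A ＠ w) ∷ Δ ⊢ B ＠ w → Γ ⨾ Δ ⊢ A ⊸ B ＠ w
    ⊸E : ∀ {Γ Δ Δ' Δ₀ A B w} → Δ₀ ↭ Δ ++ Δ' →
         Γ ⨾ Δ ⊢ A ⊸ B ＠ w → Γ ⨾ Δ' ⊢ A ＠ w → Γ ⨾ Δ₀ ⊢ B ＠ w

    &I  : ∀ {Γ Δ A B w} → Γ ⨾ Δ ⊢ A ＠ w → Γ ⨾ Δ ⊢ B ＠ w → Γ ⨾ Δ ⊢ A & B ＠ w
    &E₁ : ∀ {Γ Δ A B w} → Γ ⨾ Δ ⊢ A & B ＠ w → Γ ⨾ Δ ⊢ A ＠ w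
    &E₂ : ∀ {Γ Δ A B w} → Γ ⨾ Δ ⊢ A & B ＠ w → Γ ⨾ Δ ⊢ B ＠ w

    ⊕I₁ : ∀ {Γ Δ A B w} → Γ ⨾ Δ ⊢ A ＠ w → Γ ⨾ Δ ⊢ A ⊕ B ＠ w
    ⊕I₂ : ∀ {Γ Δ A B w} → Γ ⨾ Δ ⊢ B ＠ w → Γ ⨾ Δ ⊢ A ⊕ B ＠ w
    ⊕E  : ∀ {Γ Δ Δ' Δ₀ A B C w w'} → Δ₀ ↭ Δ ++ Δ' →
          Γ ⨾ Δ ⊢ A ⊕ B ＠ w →
          Γ ⨾ (A ＠ w) ∷ Δ' ⊢ C ＠ w' → Γ ⨾ (B ＠ w) ∷ Δ' ⊢ C ＠ w' →
          Γ ⨾ Δ₀ ⊢ C ＠ w'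

    ⊤I : ∀ {Γ Δ w} → Γ ⨾ Δ ⊢ ⊤ₚ ＠ w
    𝟘E : ∀ {Γ Δ Δ' Δ₀ C w w'} → Δ₀ ↭ Δ ++ Δ' →
         Γ ⨾ Δ ⊢ 𝟘 ＠ w → Γ ⨾ Δ₀ ⊢ C ＠ w'

    ∀tI : ∀ {Γ Δ A w} → map ↑tJ Γ ⨾ map ↑tJ Δ ⊢ A ＠ w → Γ ⨾ Δ ⊢ all-t A ＠ w
    ∀tE : ∀ {Γ Δ A w} (t : Term) → Γ ⨾ Δ ⊢ all-t A ＠ w → Γ ⨾ Δ ⊢ instT t A ＠ w
    ∃tI : ∀ {Γ Δ A w} (t : Term) → Γ ⨾ Δ ⊢ instT t A ＠ w → Γ ⨾ Δ ⊢ ex-t A ＠ w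
    ∃tE : ∀ {Γ Δ Δ' Δ₀ A C w w'} → Δ₀ ↭ Δ ++ Δ' →
          Γ ⨾ Δ ⊢ ex-t A ＠ w →
          map ↑tJ Γ ⨾ (A ＠ w) ∷ map ↑tJ Δ' ⊢ ↑tJ (C ＠ w') →
          Γ ⨾ Δ₀ ⊢ C ＠ w'

    ∀wI : ∀ {Γ Δ A w} → map ↑wJ Γ ⨾ map ↑wJ Δ ⊢ A ＠ shiftWW zero w →
          Γ ⨾ Δ ⊢ all-w A ＠ w
    ∀wE : ∀ {Γ Δ A w} (u : World) → Γ ⨾ Δ ⊢ all-w A ＠ w → Γ ⨾ Δ ⊢ instW u A ＠ w
    ∃wI : ∀ {Γ Δ A w} (u : World) → Γ ⨾ Δ ⊢ instW u A ＠ w → Γ ⨾ Δ ⊢ ex-w A ＠ w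
    ∃wE : ∀ {Γ Δ Δ' Δ₀ A C w w'} → Δ₀ ↭ Δ ++ Δ' →
          Γ ⨾ Δ ⊢ ex-w A ＠ w →
          map ↑wJ Γ ⨾ (A ＠ shiftWW zero w) ∷ map ↑wJ Δ' ⊢ ↑wJ (C ＠ w') →
          Γ ⨾ Δ₀ ⊢ C ＠ w'

    !I : ∀ {Γ A w} → Γ ⨾ [] ⊢ A ＠ w → Γ ⨾ [] ⊢ ! A ＠ w
    !E : ∀ {Γ Δ Δ' Δ₀ A C w w'} → Δ₀ ↭ Δ ++ Δ' →
         Γ ⨾ Δ ⊢ ! A ＠ w → (A ＠ w) ∷ Γ ⨾ Δ' ⊢ C ＠ w' → Γ ⨾ Δ₀ ⊢ C ＠ w'

    atI : ∀ {Γ Δ A w w'} → Γ ⨾ Δ ⊢ A ＠ w → Γ ⨾ Δ ⊢ (A at w) ＠ w'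
    atE : ∀ {Γ Δ A w w'} → Γ ⨾ Δ ⊢ (A at w) ＠ w' → Γ ⨾ Δ ⊢ A ＠ w

    ↓I : ∀ {Γ Δ A w} → Γ ⨾ Δ ⊢ instW w A ＠ w → Γ ⨾ Δ ⊢ down A ＠ w
    ↓E : ∀ {Γ Δ A w} → Γ ⨾ Δ ⊢ down A ＠ w → Γ ⨾ Δ ⊢ instW w A ＠ w

module Submission where

open import Level using (Level)
open import Data.Nat using (suc)
open import Function using (_∘_)
open import Data.List using ([]; _∷_; _++_; map)
open import Relation.Nullary using (¬_)
open import Algebra.Bundles using (Monoid)
open import Defs
open import Data.Unit using (tt) renaming (⊤ to Unit)
open import Data.Empty using (⊥; ⊥-elim)
open import Data.Product using (_×_; _,_; proj₁; proj₂)
open import Data.Sum using (_⊎_; inj₁; inj₂; [_,_]′)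
open import Relation.Binary.PropositionalEquality using (_≡_; refl; cong₂; subst; sym)
open import Data.List.Relation.Unary.All as All using (All; []; _∷_; lookup)
open import Data.List.Relation.Unary.All.Properties using (map⁺; ++⁻ˡ; ++⁻ʳ)
open import Data.List.Relation.Binary.Permutation.Propositional using (_↭_)
open import Data.List.Relation.Binary.Permutation.Propositional.Properties using (All-resp-↭)

-- Consistency of HyLL natural deduction by an erasure model.
--
-- Every HyLL proposition is read as an Agda type by forgetting everything
-- that is specific to HyLL: worlds, terms and quantifiers are erased, atoms
-- become the unit type, ⊗ and & both become products, ⊸ becomes the function
-- space, ⊕ a sum, ! is dropped, and 𝟘 becomes the empty type.  Because the
-- interpretation ignores terms and worlds, it is invariant under the four
-- shift and substitution operations on propositions; this is what makes the
-- quantifier and ↓ rules sound (the "at" rules are sound trivially).  Linearity is also forgotten: a linear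
-- context is read as the product of its members, so splitting a context
-- along a permutation Δ₀ ↭ Δ ++ Δ' is a projection.
--
-- Since 𝟘 denotes the empty type, a closed
-- derivation of 𝟘 ＠ w is impossible, which is mainTheorem8.

module Erasure {c ℓ : Level} (M : Monoid c ℓ) (F P : Set) where
  open HyLL M F P

  ⟦_⟧ : Prop → Set
  ⟦ atom a ts ⟧ = Unit
  ⟦ A ⊗ B ⟧     = ⟦ A ⟧ × ⟦ B ⟧
  ⟦ 𝟙 ⟧         = Unit
  ⟦ A ⊸ B ⟧     = ⟦ A ⟧ → ⟦ B ⟧
  ⟦ A & B ⟧     = ⟦ A ⟧ × ⟦ B ⟧
  ⟦ ⊤ₚ ⟧        = Unit
  ⟦ A ⊕ B ⟧     = ⟦ A ⟧ ⊎ ⟦ B ⟧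
  ⟦ 𝟘 ⟧         = ⊥
  ⟦ ! A ⟧       = ⟦ A ⟧
  ⟦ all-t A ⟧   = ⟦ A ⟧
  ⟦ ex-t A ⟧    = ⟦ A ⟧
  ⟦ A at w ⟧    = ⟦ A ⟧
  ⟦ down A ⟧    = ⟦ A ⟧
  ⟦ all-w A ⟧   = ⟦ A ⟧
  ⟦ ex-w A ⟧    = ⟦ A ⟧

  ⇒-cong : ∀ {X X' Y Y' : Set} → X ≡ X' → Y ≡ Y' → (X → Y) ≡ (X' → Y')
  ⇒-cong = cong₂ (λ X Y → X → Y)

  transport : ∀ {X Y : Set} → X ≡ Y → X → Y
  transport = subst (λ X → X)

  ⟦shiftTP⟧ : ∀ k A → ⟦ shiftTP k A ⟧ ≡ ⟦ A ⟧
  ⟦shiftTP⟧ k (atom a ts) = refl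
  ⟦shiftTP⟧ k (A ⊗ B)     = cong₂ _×_ (⟦shiftTP⟧ k A) (⟦shiftTP⟧ k B)
  ⟦shiftTP⟧ k 𝟙           = refl
  ⟦shiftTP⟧ k (A ⊸ B)     = ⇒-cong (⟦shiftTP⟧ k A) (⟦shiftTP⟧ k B)
  ⟦shiftTP⟧ k (A & B)     = cong₂ _×_ (⟦shiftTP⟧ k A) (⟦shiftTP⟧ k B)
  ⟦shiftTP⟧ k ⊤ₚ          = refl
  ⟦shiftTP⟧ k (A ⊕ B)     = cong₂ _⊎_ (⟦shiftTP⟧ k A) (⟦shiftTP⟧ k B)
  ⟦shiftTP⟧ k 𝟘           = refl
  ⟦shiftTP⟧ k (! A)       = ⟦shiftTP⟧ k A
  ⟦shiftTP⟧ k (all-t A)   = ⟦shiftTP⟧ (suc k) A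
  ⟦shiftTP⟧ k (ex-t A)    = ⟦shiftTP⟧ (suc k) A
  ⟦shiftTP⟧ k (A at w)    = ⟦shiftTP⟧ k A
  ⟦shiftTP⟧ k (down A)    = ⟦shiftTP⟧ k A
  ⟦shiftTP⟧ k (all-w A)   = ⟦shiftTP⟧ k A
  ⟦shiftTP⟧ k (ex-w A)    = ⟦shiftTP⟧ k A

  ⟦shiftWP⟧ : ∀ k A → ⟦ shiftWP k A ⟧ ≡ ⟦ A ⟧
  ⟦shiftWP⟧ k (atom a ts) = refl
  ⟦shiftWP⟧ k (A ⊗ B)     = cong₂ _×_ (⟦shiftWP⟧ k A) (⟦shiftWP⟧ k B)
  ⟦shiftWP⟧ k 𝟙           = refl
  ⟦shiftWP⟧ k (A ⊸ B)     = ⇒-cong (⟦shiftWP⟧ k A) (⟦shiftWP⟧ k B)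
  ⟦shiftWP⟧ k (A & B)     = cong₂ _×_ (⟦shiftWP⟧ k A) (⟦shiftWP⟧ k B)
  ⟦shiftWP⟧ k ⊤ₚ          = refl
  ⟦shiftWP⟧ k (A ⊕ B)     = cong₂ _⊎_ (⟦shiftWP⟧ k A) (⟦shiftWP⟧ k B)
  ⟦shiftWP⟧ k 𝟘           = refl
  ⟦shiftWP⟧ k (! A)       = ⟦shiftWP⟧ k A
  ⟦shiftWP⟧ k (all-t A)   = ⟦shiftWP⟧ k A
  ⟦shiftWP⟧ k (ex-t A)    = ⟦shiftWP⟧ k A
  ⟦shiftWP⟧ k (A at w)    = ⟦shiftWP⟧ k A
  ⟦shiftWP⟧ k (down A)    = ⟦shiftWP⟧ (suc k) A
  ⟦shiftWP⟧ k (all-w A)   = ⟦shiftWP⟧ (suc k) A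
  ⟦shiftWP⟧ k (ex-w A)    = ⟦shiftWP⟧ (suc k) A

  ⟦substTP⟧ : ∀ k t A → ⟦ substTP k t A ⟧ ≡ ⟦ A ⟧
  ⟦substTP⟧ k t (atom a ts) = refl
  ⟦substTP⟧ k t (A ⊗ B)     = cong₂ _×_ (⟦substTP⟧ k t A) (⟦substTP⟧ k t B)
  ⟦substTP⟧ k t 𝟙           = refl
  ⟦substTP⟧ k t (A ⊸ B)     = ⇒-cong (⟦substTP⟧ k t A) (⟦substTP⟧ k t B)
  ⟦substTP⟧ k t (A & B)     = cong₂ _×_ (⟦substTP⟧ k t A) (⟦substTP⟧ k t B)
  ⟦substTP⟧ k t ⊤ₚ          = refl
  ⟦substTP⟧ k t (A ⊕ B)     = cong₂ _⊎_ (⟦substTP⟧ k t A) (⟦substTP⟧ k t B)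
  ⟦substTP⟧ k t 𝟘           = refl
  ⟦substTP⟧ k t (! A)       = ⟦substTP⟧ k t A
  ⟦substTP⟧ k t (all-t A)   = ⟦substTP⟧ (suc k) (shiftTm 0 t) A
  ⟦substTP⟧ k t (ex-t A)    = ⟦substTP⟧ (suc k) (shiftTm 0 t) A
  ⟦substTP⟧ k t (A at w)    = ⟦substTP⟧ k t A
  ⟦substTP⟧ k t (down A)    = ⟦substTP⟧ k t A
  ⟦substTP⟧ k t (all-w A)   = ⟦substTP⟧ k t A
  ⟦substTP⟧ k t (ex-w A)    = ⟦substTP⟧ k t A

  ⟦substWP⟧ : ∀ k u A → ⟦ substWP k u A ⟧ ≡ ⟦ A ⟧
  ⟦substWP⟧ k u (atom a ts) = refl
  ⟦substWP⟧ k u (A ⊗ B)     = cong₂ _×_ (⟦substWP⟧ k u A) (⟦substWP⟧ k u B)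
  ⟦substWP⟧ k u 𝟙           = refl
  ⟦substWP⟧ k u (A ⊸ B)     = ⇒-cong (⟦substWP⟧ k u A) (⟦substWP⟧ k u B)
  ⟦substWP⟧ k u (A & B)     = cong₂ _×_ (⟦substWP⟧ k u A) (⟦substWP⟧ k u B)
  ⟦substWP⟧ k u ⊤ₚ          = refl
  ⟦substWP⟧ k u (A ⊕ B)     = cong₂ _⊎_ (⟦substWP⟧ k u A) (⟦substWP⟧ k u B)
  ⟦substWP⟧ k u 𝟘           = refl
  ⟦substWP⟧ k u (! A)       = ⟦substWP⟧ k u A
  ⟦substWP⟧ k u (all-t A)   = ⟦substWP⟧ k u A
  ⟦substWP⟧ k u (ex-t A)    = ⟦substWP⟧ k u A
  ⟦substWP⟧ k u (A at w)    = ⟦substWP⟧ k u A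
  ⟦substWP⟧ k u (down A)    = ⟦substWP⟧ (suc k) (shiftWW 0 u) A
  ⟦substWP⟧ k u (all-w A)   = ⟦substWP⟧ (suc k) (shiftWW 0 u) A
  ⟦substWP⟧ k u (ex-w A)    = ⟦substWP⟧ (suc k) (shiftWW 0 u) A

  ⟦_⟧ʲ : Jdg → Set
  ⟦ A ＠ w ⟧ʲ = ⟦ A ⟧

  Holds : Ctx → Set c
  Holds = All ⟦_⟧ʲ

  ↑t-holds : ∀ {Γ} → Holds Γ → Holds (map ↑tJ Γ)
  ↑t-holds = map⁺ ∘ All.map λ { {A ＠ w} a → transport (sym (⟦shiftTP⟧ 0 A)) a }

  ↑w-holds : ∀ {Γ} → Holds Γ → Holds (map ↑wJ Γ)
  ↑w-holds = map⁺ ∘ All.map λ { {A ＠ w} a → transport (sym (⟦shiftWP⟧ 0 A)) a }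

  split : ∀ {Δ₀} Δ {Δ'} → Δ₀ ↭ Δ ++ Δ' → Holds Δ₀ → Holds Δ × Holds Δ'
  split Δ p h = let h' = All-resp-↭ p h in ++⁻ˡ Δ h' , ++⁻ʳ Δ h'

  sound : ∀ {Γ Δ J} → Γ ⨾ Δ ⊢ J → Holds Γ → Holds Δ → ⟦ J ⟧ʲ
  sound hyp      γ (a ∷ []) = a
  sound (hyp! x) γ δ        = lookup γ x
  sound (⊗I {Δ = Δ} p x y) γ δ =
    let (δ₁ , δ₂) = split Δ p δ in sound x γ δ₁ , sound y γ δ₂
  sound (⊗E {Δ = Δ} p x y) γ δ =
    let (δ₁ , δ₂) = split Δ p δ ; (a , b) = sound x γ δ₁
    in sound y γ (a ∷ b ∷ δ₂)
  sound 𝟙I γ δ = tt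
  sound (𝟙E {Δ = Δ} p x y) γ δ = sound y γ (proj₂ (split Δ p δ))
  sound (⊸I x) γ δ = λ a → sound x γ (a ∷ δ)
  sound (⊸E {Δ = Δ} p x y) γ δ =
    let (δ₁ , δ₂) = split Δ p δ in sound x γ δ₁ (sound y γ δ₂)
  sound (&I x y) γ δ = sound x γ δ , sound y γ δ
  sound (&E₁ x)  γ δ = proj₁ (sound x γ δ)
  sound (&E₂ x)  γ δ = proj₂ (sound x γ δ)
  sound (⊕I₁ x)  γ δ = inj₁ (sound x γ δ)
  sound (⊕I₂ x)  γ δ = inj₂ (sound x γ δ)
  sound (⊕E {Δ = Δ} p x y z) γ δ =
    let (δ₁ , δ₂) = split Δ p δ
    in [ (λ a → sound y γ (a ∷ δ₂)) , (λ b → sound z γ (b ∷ δ₂)) ]′ (sound x γ δ₁)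
  sound ⊤I γ δ = tt
  sound (𝟘E {Δ = Δ} p x) γ δ = ⊥-elim (sound x γ (proj₁ (split Δ p δ)))
  sound (∀tI x) γ δ = sound x (↑t-holds γ) (↑t-holds δ)
  sound (∀tE {A = A} t x) γ δ = transport (sym (⟦substTP⟧ 0 t A)) (sound x γ δ)
  sound (∃tI {A = A} t x) γ δ = transport (⟦substTP⟧ 0 t A) (sound x γ δ)
  sound (∃tE {Δ = Δ} {C = C} p x y) γ δ =
    let (δ₁ , δ₂) = split Δ p δ
    in transport (⟦shiftTP⟧ 0 C) (sound y (↑t-holds γ) (sound x γ δ₁ ∷ ↑t-holds δ₂))
  sound (∀wI x) γ δ = sound x (↑w-holds γ) (↑w-holds δ)
  sound (∀wE {A = A} u x) γ δ = transport (sym (⟦substWP⟧ 0 u A)) (sound x γ δ)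
  sound (∃wI {A = A} u x) γ δ = transport (⟦substWP⟧ 0 u A) (sound x γ δ)
  sound (∃wE {Δ = Δ} {C = C} p x y) γ δ =
    let (δ₁ , δ₂) = split Δ p δ
    in transport (⟦shiftWP⟧ 0 C) (sound y (↑w-holds γ) (sound x γ δ₁ ∷ ↑w-holds δ₂))
  sound (!I x) γ δ = sound x γ δ
  sound (!E {Δ = Δ} p x y) γ δ =
    let (δ₁ , δ₂) = split Δ p δ in sound y (sound x γ δ₁ ∷ γ) δ₂
  sound (atI x) γ δ = sound x γ δ
  sound (atE x) γ δ = sound x γ δ
  sound (↓I {A = A} {w = w} x) γ δ = transport (⟦substWP⟧ 0 w A) (sound x γ δ)
  sound (↓E {A = A} {w = w} x) γ δ = transport (sym (⟦substWP⟧ 0 w A)) (sound x γ δ)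

mainTheorem8 : ∀ {c ℓ : Level} (M : Monoid c ℓ) (F P : Set) →
    let open HyLL M F P in
    (w : World) → ¬ ([] ⨾ [] ⊢ 𝟘 ＠ w)
mainTheorem8 M F P w derivation = Erasure.sound M F P derivation [] []
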